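{- For integers $m,u,p\ge 1$ and $n,v\ge 0$, in $\mathfrak{h}_t^1$ $$ \begin{aligned} z_m z_p^n \overset{t}{\ast} z_u z_p^v ={}&\sum_{i=1}^{n}z_m\big\{z_p^i z_u+(1-2t)z_p^{i-1}z_{u+p}+(1-\delta_{v,0}\delta_{n,i})(t^2-t)z_p^{i-1}x^{u+p}\big\}\big(z_p^{v}\overset{t}{\ast} z_p^{n-i}\big)\\ &+\sum_{i=1}^{v}z_u\big\{z_p^i z_m+(1-2t)z_p^{i-1}z_{m+p}+(1-\delta_{n,0}\delta_{v,i})(t^2-t)z_p^{i-1}x^{m+p}\big\}\big(z_p^{n}\overset{t}{\ast} z_p^{v-i}\big)\\ &+\big\{z_m z_u+z_u z_m+(1-2t)z_{m+u}+(1-\delta_{n,0}\delta_{v,0})(t^2-t)x^{m+u}\big\}\big(z_p^{n}\overset{t}{\ast} z_p^{v}\big). \end{aligned} $$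
   Context: Let $A=\{x,y\}$ be two noncommuting letters, $A^*$ the set of all words in $A$ including the empty word $1$, and $\mathfrak{h}_t=\mathbb{Q}[t]\langle A\rangle$ the noncommutative polynomial algebra over $\mathbb{Q}[t]$ generated by $A$ (product = concatenation). Put $\mathfrak{h}_t^1=\mathbb{Q}[t]+\mathfrak{h}_t y$ and, for each positive integer $k$, $z_k=x^{k-1}y$. The t-stuffle product $\overset{t}{\ast}$ on $\mathfrak{h}_t^1$ is the $\mathbb{Q}[t]$-bilinear product determined by: (i) $1\overset{t}{\ast}w=w\overset{t}{\ast}1=w$; (ii) $$z_kw_1\overset{t}{\ast} z_lw_2 = z_k(w_1\overset{t}{\ast} z_lw_2) + z_l(z_kw_1\overset{t}{\ast} w_2)+(1-2t)z_{k+l}(w_1\overset{t}{\ast} w_2)+ [1-\delta(w_1)\delta(w_2)](t^2-t)x^{k+l}(w_1\overset{t}{\ast} w_2)$$ for all words $w,w_1,w_2\in A^*\cap\mathfrak{h}_t^1$ and all positive integers $k,l$, where $\delta(w)=1$ if $w=1$ and $\delta(w)=0$ otherwise. $z_p^n$ is the $n$-fold concatenation power, $z_p^0=1$; $\delta_{i,j}$ is Kronecker's delta; empty sums are $0$. Juxtaposition denotes concatenation. -}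

module Defs where

open import Algebra.Bundles using (CommutativeMonoid; CommutativeRing; Ring; Semiring)
open import Algebra.Structures using (IsMonoid)
open import Data.Bool.Base using (if_then_else_)
open import Data.Fin.Base using (Fin; toℕ)
open import Data.List.Base
  using (List; []; _∷_; _++_; _∷ʳ_; map; concatMap; length; replicate)
open import Data.List.Properties using (++-isMonoid; ++-assoc; ++-identityʳ; ≡-dec)
open import Data.Maybe.Base as Maybe using (Maybe; just; nothing)
open import Data.Nat.Base as ℕ using (ℕ; zero; suc; _∸_; s≤s; z≤n)
import Data.Nat.Properties as ℕₚ
open import Data.Product.Base using (∃; ∃₂; _×_; _,_)
import Data.Rational.Properties as ℚₚ
open import Function.Base using (flip)
open import Data.Sum.Base using (_⊎_; inj₁; inj₂)
open import Level using (0ℓ)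
open import Relation.Binary.Definitions using (DecidableEquality)
open import Relation.Binary.PropositionalEquality as ≡ using (_≡_; refl)
open import Relation.Nullary using (does; yes; no; contradiction)

-- The monoid algebra R[M].  An element is a formal sum of terms c·m, possibly
-- with repetitions; two formal sums are equal when all coefficients agree.

module MonoidAlgebra
  {c ℓ} (R : CommutativeRing c ℓ)
  {M : Set} {_∙_ : M → M → M} {ε : M}
  (isMonoid : IsMonoid _≡_ _∙_ ε) (_≟_ : DecidableEquality M)
  where

  private
    module R = CommutativeRing R
    module M = IsMonoid isMonoid
  open R using (0#; 1#) renaming (Carrier to K; _≈_ to _≈ᴿ_; _+_ to _+ᴿ_; _*_ to _*ᴿ_; -_ to -ᴿ_)
  open import Relation.Binary.Reasoning.Setoid R.setoid
  open import Algebra.Properties.CommutativeSemigroup R.+-commutativeSemigroup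
    using (interchange)
  open import Algebra.Properties.CommutativeSemigroup R.*-commutativeSemigroup
    using (x∙yz≈y∙xz)
  open import Algebra.Properties.Ring R.ring
    using (-1*x≈-x; x≈y⇒x∙y⁻¹≈ε; x∙y⁻¹≈ε⇒x≈y)

  Carrier : Set c
  Carrier = List (K × M)

  -- Σ cᵢ mᵢ ↦ Σ cᵢ F(mᵢ)
  eval : (M → K) → Carrier → K
  eval F []            = 0#
  eval F ((c , m) ∷ f) = c *ᴿ F m +ᴿ eval F f

  [_≡_] : M → M → K
  [ k ≡ m ] = if does (k ≟ m) then 1# else 0#

  coeff : Carrier → M → K
  coeff f m = eval (λ k → [ k ≡ m ]) f

  infix 4 _≈_
  record _≈_ (f g : Carrier) : Set ℓ where
    constructor mk≈
    field coeff-≈ : ∀ m → coeff f m ≈ᴿ coeff g m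
  open _≈_ public

  infixl 6 _+_
  infixl 8 _·_
  infixr 7 _•_
  infix  9 -_

  -- The operations are opaque so that unification does not expand formal sums.
  opaque
    _+_ : Carrier → Carrier → Carrier
    _+_ = _++_

    _•_ : K → Carrier → Carrier
    c • f = map (λ (d , m) → (c *ᴿ d , m)) f

  -_ : Carrier → Carrier
  - f = (-ᴿ 1#) • f

  term : K → M → Carrier
  term c m = (c , m) ∷ []

  ⟨_⟩ : M → Carrier
  ⟨ m ⟩ = term 1# m

  0ᴬ 1ᴬ : Carrier
  0ᴬ = []
  1ᴬ = ⟨ ε ⟩

  opaque
    linear : (M → Carrier) → Carrier → Carrier
    linear F f = concatMap (λ (c , m) → c • F m) f

  bilinear : (M → M → Carrier) → Carrier → Carrier → Carrier
  bilinear B f g = linear (λ m → linear (B m) g) f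

  private
    ∙ᴬ : M → M → Carrier
    ∙ᴬ m n = ⟨ m ∙ n ⟩

  opaque
    _·_ : Carrier → Carrier → Carrier
    _·_ = bilinear ∙ᴬ

  opaque
    unfolding _+_

    eval-+ : ∀ F f g → eval F (f + g) ≈ᴿ eval F f +ᴿ eval F g
    eval-+ F []            g = R.sym (R.+-identityˡ _)
    eval-+ F ((c , m) ∷ f) g = begin
      c *ᴿ F m +ᴿ eval F (f + g)           ≈⟨ R.+-congˡ (eval-+ F f g) ⟩
      c *ᴿ F m +ᴿ (eval F f +ᴿ eval F g)   ≈⟨ R.+-assoc _ _ _ ⟨
      c *ᴿ F m +ᴿ eval F f +ᴿ eval F g     ∎

  opaque
    unfolding _•_

    eval-• : ∀ F c f → eval F (c • f) ≈ᴿ c *ᴿ eval F f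
    eval-• F c []            = R.sym (R.zeroʳ c)
    eval-• F c ((d , m) ∷ f) = begin
      c *ᴿ d *ᴿ F m +ᴿ eval F (c • f)      ≈⟨ R.+-cong (R.*-assoc c d (F m)) (eval-• F c f) ⟩
      c *ᴿ (d *ᴿ F m) +ᴿ c *ᴿ eval F f     ≈⟨ R.distribˡ c _ _ ⟨
      c *ᴿ (d *ᴿ F m +ᴿ eval F f)          ∎

  eval-- : ∀ F f → eval F (- f) ≈ᴿ -ᴿ eval F f
  eval-- F f = R.trans (eval-• F (-ᴿ 1#) f) (-1*x≈-x _)

  eval-⟨⟩ : ∀ F m → eval F ⟨ m ⟩ ≈ᴿ F m
  eval-⟨⟩ F m = R.trans (R.+-identityʳ _) (R.*-identityˡ _)

  eval-cong : ∀ {F G} → (∀ m → F m ≈ᴿ G m) → ∀ f → eval F f ≈ᴿ eval G f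
  eval-cong F≈G []            = R.refl
  eval-cong F≈G ((c , m) ∷ f) = R.+-cong (R.*-congˡ (F≈G m)) (eval-cong F≈G f)

  eval-0ᶠ : ∀ f → eval (λ _ → 0#) f ≈ᴿ 0#
  eval-0ᶠ []            = R.refl
  eval-0ᶠ ((c , m) ∷ f) = R.trans (R.+-cong (R.zeroʳ c) (eval-0ᶠ f)) (R.+-identityˡ _)

  eval-+ᶠ : ∀ F G f → eval (λ m → F m +ᴿ G m) f ≈ᴿ eval F f +ᴿ eval G f
  eval-+ᶠ F G []            = R.sym (R.+-identityˡ _)
  eval-+ᶠ F G ((c , m) ∷ f) =
    R.trans (R.+-cong (R.distribˡ c _ _) (eval-+ᶠ F G f)) (interchange _ _ _ _)

  eval-*ᶠ : ∀ c F f → eval (λ m → c *ᴿ F m) f ≈ᴿ c *ᴿ eval F f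
  eval-*ᶠ c F []            = R.sym (R.zeroʳ c)
  eval-*ᶠ c F ((d , m) ∷ f) =
    R.trans (R.+-cong (x∙yz≈y∙xz d c (F m)) (eval-*ᶠ c F f)) (R.sym (R.distribˡ c _ _))

  eval-swap : ∀ (F : M → M → K) f g →
    eval (λ m → eval (F m) g) f ≈ᴿ eval (λ n → eval (λ m → F m n) f) g
  eval-swap F []            g = R.sym (eval-0ᶠ g)
  eval-swap F ((c , m) ∷ f) g = begin
    c *ᴿ eval (F m) g +ᴿ eval (λ m → eval (F m) g) f
      ≈⟨ R.+-cong (R.sym (eval-*ᶠ c (F m) g)) (eval-swap F f g) ⟩
    eval (λ n → c *ᴿ F m n) g +ᴿ eval (λ n → eval (λ m → F m n) f) g
      ≈⟨ eval-+ᶠ _ _ g ⟨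
    eval (λ n → c *ᴿ F m n +ᴿ eval (λ m → F m n) f) g ∎

  coeff-+ : ∀ f g k → coeff (f + g) k ≈ᴿ coeff f k +ᴿ coeff g k
  coeff-+ f g k = eval-+ (λ m → [ m ≡ k ]) f g

  coeff-• : ∀ c f k → coeff (c • f) k ≈ᴿ c *ᴿ coeff f k
  coeff-• c f k = eval-• (λ m → [ m ≡ k ]) c f

  opaque
    unfolding linear _+_

    eval-linear : ∀ G F f → eval G (linear F f) ≈ᴿ eval (λ m → eval G (F m)) f
    eval-linear G F []            = R.refl
    eval-linear G F ((c , m) ∷ f) = R.trans
      (eval-+ G (c • F m) (linear F f))
      (R.+-cong (eval-• G c (F m)) (eval-linear G F f))

  eval-bilinear : ∀ G B f g →
    eval G (bilinear B f g) ≈ᴿ eval (λ m → eval (λ n → eval G (B m n)) g) f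
  eval-bilinear G B f g =
    R.trans (eval-linear G _ f) (eval-cong (λ m → eval-linear G (B m) g) f)

  opaque
    unfolding _·_

    eval-· : ∀ G f g → eval G (f · g) ≈ᴿ eval (λ m → eval (λ n → G (m ∙ n)) g) f
    eval-· G f g = R.trans (eval-bilinear G ∙ᴬ f g)
      (eval-cong (λ m → eval-cong (λ n → eval-⟨⟩ G (m ∙ n)) g) f)

  -- Evaluation respects ≈, by collecting equal monomials.
  private
    remove : M → Carrier → Carrier
    remove m []            = []
    remove m ((c , k) ∷ f) = if does (k ≟ m) then remove m f else (c , k) ∷ remove m f

    remove-length : ∀ m f → length (remove m f) ℕ.≤ length f
    remove-length m []            = z≤n
    remove-length m ((c , k) ∷ f) with k ≟ m
    ... | yes _ = ℕₚ.m≤n⇒m≤1+n (remove-length m f)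
    ... | no  _ = s≤s (remove-length m f)

    eval-remove : ∀ F m f → eval F f ≈ᴿ coeff f m *ᴿ F m +ᴿ eval F (remove m f)
    eval-remove F m [] = R.sym (R.trans (R.+-identityʳ _) (R.zeroˡ _))
    eval-remove F m ((c , k) ∷ f) with k ≟ m
    ... | yes refl = begin
      c *ᴿ F m +ᴿ eval F f
        ≈⟨ R.+-cong (R.*-congʳ (R.sym (R.*-identityʳ c))) (eval-remove F m f) ⟩
      c *ᴿ 1# *ᴿ F m +ᴿ (coeff f m *ᴿ F m +ᴿ eval F (remove m f))
        ≈⟨ R.+-assoc _ _ _ ⟨
      c *ᴿ 1# *ᴿ F m +ᴿ coeff f m *ᴿ F m +ᴿ eval F (remove m f)
        ≈⟨ R.+-congʳ (R.distribʳ _ _ _) ⟨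
      (c *ᴿ 1# +ᴿ coeff f m) *ᴿ F m +ᴿ eval F (remove m f) ∎
    ... | no _ = begin
      c *ᴿ F k +ᴿ eval F f
        ≈⟨ R.+-cong (R.sym (R.+-identityˡ _)) (eval-remove F m f) ⟩
      (0# +ᴿ c *ᴿ F k) +ᴿ (coeff f m *ᴿ F m +ᴿ eval F (remove m f))
        ≈⟨ interchange _ _ _ _ ⟩
      (0# +ᴿ coeff f m *ᴿ F m) +ᴿ (c *ᴿ F k +ᴿ eval F (remove m f))
        ≈⟨ R.+-congʳ (R.trans (R.+-identityˡ _)
             (R.*-congʳ (R.sym (R.trans (R.+-congʳ (R.zeroʳ c)) (R.+-identityˡ _))))) ⟩
      (c *ᴿ 0# +ᴿ coeff f m) *ᴿ F m +ᴿ (c *ᴿ F k +ᴿ eval F (remove m f)) ∎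

    eval-remove₀ : ∀ F m f → coeff f m ≈ᴿ 0# → eval F f ≈ᴿ eval F (remove m f)
    eval-remove₀ F m f f₀ = begin
      eval F f                                     ≈⟨ eval-remove F m f ⟩
      coeff f m *ᴿ F m +ᴿ eval F (remove m f)      ≈⟨ R.+-congʳ (R.*-congʳ f₀) ⟩
      0# *ᴿ F m +ᴿ eval F (remove m f)             ≈⟨ R.+-congʳ (R.zeroˡ _) ⟩
      0# +ᴿ eval F (remove m f)                    ≈⟨ R.+-identityˡ _ ⟩
      eval F (remove m f)                          ∎

    eval-zero : ∀ F N f → length f ℕ.≤ N → (∀ k → coeff f k ≈ᴿ 0#) → eval F f ≈ᴿ 0#
    eval-zero F N       []                h       f₀ = R.refl
    eval-zero F (suc N) f@((c , m) ∷ f') (s≤s h) f₀ = R.trans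
      (eval-remove₀ F m f (f₀ m))
      (eval-zero F N (remove m f) (ℕₚ.≤-trans shorter h)
        (λ k → R.trans (R.sym (eval-remove₀ _ m f (f₀ m))) (f₀ k)))
      where
      shorter : length (remove m f) ℕ.≤ length f'
      shorter with m ≟ m
      ... | yes _   = remove-length m f'
      ... | no  m≢m = contradiction refl m≢m

  eval-resp : ∀ F {f g} → f ≈ g → eval F f ≈ᴿ eval F g
  eval-resp F {f} {g} f≈g = x∙y⁻¹≈ε⇒x≈y _ _ (R.trans (R.sym (split F))
    (eval-zero F _ (f + (- g)) ℕₚ.≤-refl
      (λ k → R.trans (split _) (x≈y⇒x∙y⁻¹≈ε (coeff-≈ f≈g k)))))
    where
    split : ∀ G → eval G (f + (- g)) ≈ᴿ eval G f +ᴿ (-ᴿ eval G g)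
    split G = R.trans (eval-+ G f (- g)) (R.+-congˡ (eval-- G g))

  bilinear-cong : ∀ B {f f' g g'} → f ≈ f' → g ≈ g' → bilinear B f g ≈ bilinear B f' g'
  bilinear-cong B {f} {f'} {g} {g'} p q = mk≈ λ k → begin
    coeff (bilinear B f g) k                       ≈⟨ eval-bilinear _ B f g ⟩
    eval (λ m → eval (λ n → coeff (B m n) k) g) f  ≈⟨ eval-cong (λ m → eval-resp _ q) f ⟩
    eval (λ m → eval (λ n → coeff (B m n) k) g') f ≈⟨ eval-resp _ p ⟩
    eval (λ m → eval (λ n → coeff (B m n) k) g') f' ≈⟨ eval-bilinear _ B f' g' ⟨
    coeff (bilinear B f' g') k                     ∎

  bilinear-+ʳ : ∀ B f g g' → bilinear B f (g + g') ≈ bilinear B f g + bilinear B f g'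
  bilinear-+ʳ B f g g' = mk≈ λ k → begin
    coeff (bilinear B f (g + g')) k
      ≈⟨ eval-bilinear _ B f (g + g') ⟩
    eval (λ m → eval (λ n → coeff (B m n) k) (g + g')) f
      ≈⟨ eval-cong (λ m → eval-+ _ g g') f ⟩
    eval (λ m → eval (λ n → coeff (B m n) k) g +ᴿ eval (λ n → coeff (B m n) k) g') f
      ≈⟨ eval-+ᶠ _ _ f ⟩
    eval (λ m → eval (λ n → coeff (B m n) k) g) f +ᴿ eval (λ m → eval (λ n → coeff (B m n) k) g') f
      ≈⟨ R.+-cong (eval-bilinear _ B f g) (eval-bilinear _ B f g') ⟨
    coeff (bilinear B f g) k +ᴿ coeff (bilinear B f g') k
      ≈⟨ eval-+ _ (bilinear B f g) _ ⟨
    coeff (bilinear B f g + bilinear B f g') k ∎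

  bilinear-+ˡ : ∀ B f f' g → bilinear B (f + f') g ≈ bilinear B f g + bilinear B f' g
  bilinear-+ˡ B f f' g = mk≈ λ k → begin
    coeff (bilinear B (f + f') g) k
      ≈⟨ eval-bilinear _ B (f + f') g ⟩
    eval (λ m → eval (λ n → coeff (B m n) k) g) (f + f')
      ≈⟨ eval-+ _ f f' ⟩
    eval (λ m → eval (λ n → coeff (B m n) k) g) f +ᴿ eval (λ m → eval (λ n → coeff (B m n) k) g) f'
      ≈⟨ R.+-cong (eval-bilinear _ B f g) (eval-bilinear _ B f' g) ⟨
    coeff (bilinear B f g) k +ᴿ coeff (bilinear B f' g) k
      ≈⟨ eval-+ _ (bilinear B f g) _ ⟨
    coeff (bilinear B f g + bilinear B f' g) k ∎

  bilinear-•ˡ : ∀ B c f g → bilinear B (c • f) g ≈ c • bilinear B f g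
  bilinear-•ˡ B c f g = mk≈ λ k → begin
    coeff (bilinear B (c • f) g) k
      ≈⟨ eval-bilinear _ B (c • f) g ⟩
    eval (λ m → eval (λ n → coeff (B m n) k) g) (c • f)
      ≈⟨ eval-• _ c f ⟩
    c *ᴿ eval (λ m → eval (λ n → coeff (B m n) k) g) f
      ≈⟨ R.*-congˡ (eval-bilinear _ B f g) ⟨
    c *ᴿ coeff (bilinear B f g) k
      ≈⟨ eval-• _ c (bilinear B f g) ⟨
    coeff (c • bilinear B f g) k ∎

  bilinear-•ʳ : ∀ B c f g → bilinear B f (c • g) ≈ c • bilinear B f g
  bilinear-•ʳ B c f g = mk≈ λ k → begin
    coeff (bilinear B f (c • g)) k
      ≈⟨ eval-bilinear _ B f (c • g) ⟩
    eval (λ m → eval (λ n → coeff (B m n) k) (c • g)) f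
      ≈⟨ eval-cong (λ m → eval-• _ c g) f ⟩
    eval (λ m → c *ᴿ eval (λ n → coeff (B m n) k) g) f
      ≈⟨ eval-*ᶠ c _ f ⟩
    c *ᴿ eval (λ m → eval (λ n → coeff (B m n) k) g) f
      ≈⟨ R.*-congˡ (eval-bilinear _ B f g) ⟨
    c *ᴿ coeff (bilinear B f g) k
      ≈⟨ eval-• _ c (bilinear B f g) ⟨
    coeff (c • bilinear B f g) k ∎

  bilinear-⟨⟩ : ∀ B m n → bilinear B ⟨ m ⟩ ⟨ n ⟩ ≈ B m n
  bilinear-⟨⟩ B m n = mk≈ λ k → begin
    coeff (bilinear B ⟨ m ⟩ ⟨ n ⟩) k                         ≈⟨ eval-bilinear _ B ⟨ m ⟩ ⟨ n ⟩ ⟩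
    eval (λ m' → eval (λ n' → coeff (B m' n') k) ⟨ n ⟩) ⟨ m ⟩
      ≈⟨ eval-⟨⟩ (λ m' → eval (λ n' → coeff (B m' n') k) ⟨ n ⟩) m ⟩
    eval (λ n' → coeff (B m n') k) ⟨ n ⟩                     ≈⟨ eval-⟨⟩ (λ n' → coeff (B m n') k) n ⟩
    coeff (B m n) k                                          ∎

  opaque
    unfolding _·_

    ⟨⟩-· : ∀ m n → ⟨ m ⟩ · ⟨ n ⟩ ≈ ⟨ m ∙ n ⟩
    ⟨⟩-· = bilinear-⟨⟩ ∙ᴬ

  •-cong : ∀ {c d f g} → c ≈ᴿ d → f ≈ g → c • f ≈ d • g
  •-cong {c} {d} {f} {g} c≈d f≈g = mk≈ λ k → R.trans (eval-• _ c f)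
    (R.trans (R.*-cong c≈d (coeff-≈ f≈g k)) (R.sym (eval-• _ d g)))

  opaque
    unfolding _·_

    •-· : ∀ c f g → (c • f) · g ≈ c • (f · g)
    •-· = bilinear-•ˡ ∙ᴬ

    ·-• : ∀ c f g → f · (c • g) ≈ c • (f · g)
    ·-• = bilinear-•ʳ ∙ᴬ

  opaque
    unfolding _·_

    ·-cong : ∀ {f f' g g'} → f ≈ f' → g ≈ g' → f · g ≈ f' · g'
    ·-cong = bilinear-cong ∙ᴬ

    ·-+ʳ : ∀ f g h → f · (g + h) ≈ f · g + f · h
    ·-+ʳ = bilinear-+ʳ ∙ᴬ

    ·-+ˡ : ∀ f g h → (f + g) · h ≈ f · h + g · h
    ·-+ˡ = bilinear-+ˡ ∙ᴬ

  opaque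
    unfolding _+_

    +-assoc : ∀ f g h → (f + g) + h ≈ f + (g + h)
    +-assoc f g h = mk≈ λ k → R.reflexive (≡.cong (λ a → coeff a k) (++-assoc f g h))

    +-identityˡ : ∀ f → 0ᴬ + f ≈ f
    +-identityˡ f = mk≈ λ k → R.refl

    +-identityʳ : ∀ f → f + 0ᴬ ≈ f
    +-identityʳ f = mk≈ λ k → R.reflexive (≡.cong (λ a → coeff a k) (++-identityʳ f))

  private
    eval² : ∀ F f g h → eval F ((f · g) · h) ≈ᴿ eval F (f · (g · h))
    eval² F f g h = begin
      eval F ((f · g) · h)
        ≈⟨ eval-· F (f · g) h ⟩
      eval (λ k → eval (λ l → F (k ∙ l)) h) (f · g)
        ≈⟨ eval-· _ f g ⟩
      eval (λ m → eval (λ n → eval (λ l → F ((m ∙ n) ∙ l)) h) g) f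
        ≈⟨ eval-cong (λ m → eval-cong (λ n → eval-cong (λ l →
             R.reflexive (≡.cong F (M.assoc m n l))) h) g) f ⟩
      eval (λ m → eval (λ n → eval (λ l → F (m ∙ (n ∙ l))) h) g) f
        ≈⟨ eval-cong (λ m → eval-· _ g h) f ⟨
      eval (λ m → eval (λ k → F (m ∙ k)) (g · h)) f
        ≈⟨ eval-· F f (g · h) ⟨
      eval F (f · (g · h)) ∎

    ·-identityˡ : ∀ f → 1ᴬ · f ≈ f
    ·-identityˡ f = mk≈ λ k → R.trans (eval-· _ 1ᴬ f) (R.trans (eval-⟨⟩ (λ m → eval (λ n → [ m ∙ n ≡ k ]) f) ε)
      (eval-cong (λ n → R.reflexive (≡.cong [_≡ k ] (M.identityˡ n))) f))

    ·-identityʳ : ∀ f → f · 1ᴬ ≈ f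
    ·-identityʳ f = mk≈ λ k → R.trans (eval-· _ f 1ᴬ)
      (eval-cong (λ m → R.trans (eval-⟨⟩ (λ n → [ m ∙ n ≡ k ]) ε)
        (R.reflexive (≡.cong [_≡ k ] (M.identityʳ m)))) f)

  ring : Ring c ℓ
  ring = record
    { Carrier = Carrier ; _≈_ = _≈_ ; _+_ = _+_ ; _*_ = _·_ ; -_ = -_ ; 0# = 0ᴬ ; 1# = 1ᴬ
    ; isRing = record
      { +-isAbelianGroup = record
        { isGroup = record
          { isMonoid = record
            { isSemigroup = record
              { isMagma = record
                { isEquivalence = record
                  { refl  = mk≈ λ _ → R.refl
                  ; sym   = λ p → mk≈ λ k → R.sym (coeff-≈ p k)
                  ; trans = λ p q → mk≈ λ k → R.trans (coeff-≈ p k) (coeff-≈ q k)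
                  }
                ; ∙-cong = λ {f} {f'} {g} {g'} p q → mk≈ λ k → R.trans (eval-+ _ f g)
                    (R.trans (R.+-cong (coeff-≈ p k) (coeff-≈ q k)) (R.sym (eval-+ _ f' g')))
                }
              ; assoc = +-assoc
              }
            ; identity = +-identityˡ , +-identityʳ
            }
          ; inverse = (λ f → mk≈ λ k → R.trans (eval-+ _ (- f) f)
                         (R.trans (R.+-congʳ (eval-- _ f)) (R.-‿inverseˡ _)))
                    , (λ f → mk≈ λ k → R.trans (eval-+ _ f (- f))
                         (R.trans (R.+-congˡ (eval-- _ f)) (R.-‿inverseʳ _)))
          ; ⁻¹-cong = •-cong R.refl
          }
        ; comm = λ f g → mk≈ λ k → R.trans (eval-+ _ f g)
            (R.trans (R.+-comm _ _) (R.sym (eval-+ _ g f)))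
        }
      ; *-cong     = ·-cong
      ; *-assoc    = λ f g h → mk≈ λ k → eval² _ f g h
      ; *-identity = ·-identityˡ , ·-identityʳ
      ; distrib    = ·-+ʳ , (λ h f g → ·-+ˡ f g h)
      }
    }

  commutativeRing : (∀ m n → m ∙ n ≡ n ∙ m) → CommutativeRing c ℓ
  commutativeRing ∙-comm = record
    { isCommutativeRing = record
      { isRing = Ring.isRing ring
      ; *-comm = λ f g → mk≈ λ k → begin
          coeff (f · g) k
            ≈⟨ eval-· _ f g ⟩
          eval (λ m → eval (λ n → [ m ∙ n ≡ k ]) g) f
            ≈⟨ eval-swap _ f g ⟩
          eval (λ n → eval (λ m → [ m ∙ n ≡ k ]) f) g
            ≈⟨ eval-cong (λ n → eval-cong (λ m →
                 R.reflexive (≡.cong [_≡ k ] (∙-comm m n))) f) g ⟩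
          eval (λ n → eval (λ m → [ n ∙ m ≡ k ]) f) g
            ≈⟨ eval-· _ g f ⟨
          coeff (g · f) k ∎
      }
    }

-- ℚ[t] = ℚ[ℕ], where the monomial n stands for tⁿ.

private
  module Poly = MonoidAlgebra ℚₚ.+-*-commutativeRing ℕₚ.+-0-isMonoid ℕₚ._≟_

opaque
  ℚ[t]-commutativeRing : CommutativeRing 0ℓ 0ℓ
  ℚ[t]-commutativeRing = Poly.commutativeRing ℕₚ.+-comm

open CommutativeRing ℚ[t]-commutativeRing public
  using ()
  renaming (Carrier to ℚ[t]; _≈_ to _≈ₜ_; 1# to 1ₜ; 0# to 0ₜ; _*_ to infixl 7 _*ₜ_; _-_ to infixl 6 _-ₜ_)

open import Algebra.Definitions.RawSemiring
  (Semiring.rawSemiring (CommutativeRing.semiring ℚ[t]-commutativeRing)) public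
  using () renaming (_×_ to infixr 8 _×ₜ_; _^_ to infixr 8 _^ₜ_)

opaque
  unfolding ℚ[t]-commutativeRing

  t : ℚ[t]
  t = Poly.⟨ 1 ⟩

δ : ℕ → ℕ → ℚ[t]
δ i j = if does (i ℕₚ.≟ j) then 1ₜ else 0ₜ

data Letter : Set where
  lx ly : Letter

_≟ᴸ_ : DecidableEquality Letter
lx ≟ᴸ lx = yes refl
lx ≟ᴸ ly = no λ ()
ly ≟ᴸ lx = no λ ()
ly ≟ᴸ ly = yes refl

Word : Set
Word = List Letter

module H = MonoidAlgebra ℚ[t]-commutativeRing (++-isMonoid {A = Letter}) (≡-dec _≟ᴸ_)

open H public using (_≈_; _+_; _·_; _•_; ⟨_⟩) renaming (Carrier to 𝔥)
open import Algebra.Definitions.RawSemiring (Semiring.rawSemiring (Ring.semiring H.ring)) public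
  using (sum) renaming (_^_ to infixr 9 _^_)

x y : 𝔥
x = ⟨ lx ∷ [] ⟩
y = ⟨ ly ∷ [] ⟩

-- Meant for k ≥ 1; the truncated subtraction gives z 0 = y.
z : ℕ → 𝔥
z k = x ^ (k ∸ 1) · y

-- ∑ n f = f 1 + … + f n
∑ : ℕ → (ℕ → 𝔥) → 𝔥
∑ n f = sum {n} (λ (i : Fin n) → f (suc (toℕ i)))

_∈𝔥¹ : 𝔥 → Set
f ∈𝔥¹ = ∃₂ λ (c : ℚ[t]) (g : 𝔥) → f ≈ c • H.1ᴬ + g · y

Word¹ : Word → Set
Word¹ w = w ≡ [] ⊎ ∃ λ v → w ≡ v ∷ʳ ly

δ₁ : ∀ {A : Set} → List A → ℚ[t]
δ₁ []      = 1ₜ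
δ₁ (_ ∷ _) = 0ₜ

-- A list of positive integers stands for the word z_{k₁}⋯z_{kᵣ}; these are exactly
-- the words in 𝔥¹.

zs : List ℕ → 𝔥
zs []       = H.1ᴬ
zs (k ∷ ks) = z k · zs ks

_⋆ᶻ_ : List ℕ → List ℕ → 𝔥
[]       ⋆ᶻ ls       = zs ls
(k ∷ ks) ⋆ᶻ []       = zs (k ∷ ks)
(k ∷ ks) ⋆ᶻ (l ∷ ls) =
    z k · (ks ⋆ᶻ (l ∷ ls))
  + z l · ((k ∷ ks) ⋆ᶻ ls)
  + (1ₜ -ₜ 2 ×ₜ t) • z (k ℕ.+ l) · (ks ⋆ᶻ ls)
  + ((1ₜ -ₜ δ₁ ks *ₜ δ₁ ls) *ₜ (t ^ₜ 2 -ₜ t)) • x ^ (k ℕ.+ l) · (ks ⋆ᶻ ls)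

-- parse a w reads xᵃw as a product of z's; it fails exactly when xᵃw is
-- nonempty and does not end in y.
parse : ℕ → Word → Maybe (List ℕ)
parse zero    []       = just []
parse (suc _) []       = nothing
parse a       (lx ∷ w) = parse (suc a) w
parse a       (ly ∷ w) = Maybe.map (suc a ∷_) (parse 0 w)

_⋆ʷ_ : Word → Word → 𝔥
v ⋆ʷ w with parse 0 v | parse 0 w
... | just ks | just ls = ks ⋆ᶻ ls
... | _       | _       = H.0ᴬ

-- The product is meant for elements of 𝔥¹.  As a total operation on 𝔥 it is
-- extended by zero to the words outside 𝔥¹.
infixl 8 _∗ᵗ_
_∗ᵗ_ : 𝔥 → 𝔥 → 𝔥
_∗ᵗ_ = H.bilinear _⋆ʷ_

-- The remaining lemmas show that ∗ᵗ is a well-defined ℚ[t]-bilinear product with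
-- values in 𝔥¹ that satisfies its defining equations on the words in 𝔥¹.

private
  module Hᴿ = Ring H.ring
  module Pᴿ = CommutativeRing ℚ[t]-commutativeRing

∗ᵗ-cong : ∀ {f f' g g'} → f ≈ f' → g ≈ g' → f ∗ᵗ g ≈ f' ∗ᵗ g'
∗ᵗ-cong = H.bilinear-cong _⋆ʷ_

∗ᵗ-+ˡ : ∀ f f' g → (f + f') ∗ᵗ g ≈ f ∗ᵗ g + f' ∗ᵗ g
∗ᵗ-+ˡ = H.bilinear-+ˡ _⋆ʷ_

∗ᵗ-+ʳ : ∀ f g g' → f ∗ᵗ (g + g') ≈ f ∗ᵗ g + f ∗ᵗ g'
∗ᵗ-+ʳ = H.bilinear-+ʳ _⋆ʷ_

∗ᵗ-•ˡ : ∀ c f g → (c • f) ∗ᵗ g ≈ c • (f ∗ᵗ g)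
∗ᵗ-•ˡ = H.bilinear-•ˡ _⋆ʷ_

∗ᵗ-•ʳ : ∀ c f g → f ∗ᵗ (c • g) ≈ c • (f ∗ᵗ g)
∗ᵗ-•ʳ = H.bilinear-•ʳ _⋆ʷ_

x^-⟨⟩ : ∀ a → x ^ a ≈ ⟨ replicate a lx ⟩
x^-⟨⟩ zero    = Hᴿ.refl
x^-⟨⟩ (suc a) = Hᴿ.trans (Hᴿ.*-congˡ (x^-⟨⟩ a)) (H.⟨⟩-· _ _)

z-⟨⟩ : ∀ k w → z k · ⟨ w ⟩ ≈ ⟨ replicate (k ∸ 1) lx ++ ly ∷ w ⟩
z-⟨⟩ k w = Hᴿ.trans (Hᴿ.*-assoc _ _ _)
  (Hᴿ.trans (Hᴿ.*-cong (x^-⟨⟩ (k ∸ 1)) (H.⟨⟩-· _ _)) (H.⟨⟩-· _ _))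

-- f ≈z ks says that f is the word z_{k₁}⋯z_{kᵣ}.
_≈z_ : 𝔥 → List ℕ → Set
f ≈z ks = ∃ λ w → f ≈ ⟨ w ⟩ × parse 0 w ≡ just ks

private
  parse-x : ∀ b a v → parse b (replicate a lx ++ v) ≡ parse (a ℕ.+ b) v
  parse-x b zero    v = refl
  parse-x b (suc a) v = ≡.trans (parse-lx b) (≡.trans (parse-x (suc b) a v)
      (≡.cong (λ n → parse n v) (ℕₚ.+-suc a b)))
    where
    parse-lx : ∀ b {w} → parse b (lx ∷ w) ≡ parse (suc b) w
    parse-lx zero    = refl
    parse-lx (suc b) = refl

  parse-z : ∀ a w → parse 0 (replicate a lx ++ ly ∷ w) ≡ Maybe.map (suc a ∷_) (parse 0 w)
  parse-z a w rewrite parse-x 0 a (ly ∷ w) | ℕₚ.+-identityʳ a with a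
  ... | zero  = refl
  ... | suc _ = refl

  parse-∷ʳ : ∀ a v → ∃ λ ks → parse a (v ∷ʳ ly) ≡ just ks
  parse-∷ʳ zero    []       = _ , refl
  parse-∷ʳ (suc a) []       = _ , refl
  parse-∷ʳ zero    (lx ∷ v) = parse-∷ʳ 1 v
  parse-∷ʳ (suc a) (lx ∷ v) = parse-∷ʳ (suc (suc a)) v
  parse-∷ʳ zero    (ly ∷ v) with parse 0 (v ∷ʳ ly) | parse-∷ʳ 0 v
  ... | _ | ks , refl = _ , refl
  parse-∷ʳ (suc a) (ly ∷ v) with parse 0 (v ∷ʳ ly) | parse-∷ʳ 0 v
  ... | _ | ks , refl = _ , refl

  parse-nonempty : ∀ a w → parse (suc a) w ≡ just [] → ∀ {A : Set} → A
  parse-nonempty a (lx ∷ w) eq = parse-nonempty (suc a) w eq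
  parse-nonempty a (ly ∷ w) eq with parse 0 w
  parse-nonempty a (ly ∷ w) () | just _
  parse-nonempty a (ly ∷ w) () | nothing

  parse-δ₁ : ∀ w {ks} → parse 0 w ≡ just ks → δ₁ w ≡ δ₁ ks
  parse-δ₁ []       refl = refl
  parse-δ₁ (_  ∷ w) {_ ∷ _} eq = refl
  parse-δ₁ (lx ∷ w) {[]}    eq = parse-nonempty 0 w eq
  parse-δ₁ (ly ∷ w) {[]}    eq with parse 0 w
  parse-δ₁ (ly ∷ w) {[]}    () | just _
  parse-δ₁ (ly ∷ w) {[]}    () | nothing

Word¹⇒≈z : ∀ {w} → Word¹ w → ∃ λ ks → parse 0 w ≡ just ks
Word¹⇒≈z (inj₁ refl)       = [] , refl
Word¹⇒≈z (inj₂ (v , refl)) = parse-∷ʳ 0 v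

z-≈z : ∀ k {f ks} → 1 ℕ.≤ k → f ≈z ks → (z k · f) ≈z (k ∷ ks)
z-≈z (suc a) _ (w , f≈w , eq) =
    _ , Hᴿ.trans (Hᴿ.*-congˡ f≈w) (z-⟨⟩ (suc a) w)
  , ≡.trans (parse-z a w) (≡.cong (Maybe.map (suc a ∷_)) eq)

∗ᵗ-≈z : ∀ {f g ks ls} → f ≈z ks → g ≈z ls → f ∗ᵗ g ≈ ks ⋆ᶻ ls
∗ᵗ-≈z {ks = ks} {ls} (v , f≈v , p) (w , g≈w , q) =
  Hᴿ.trans (∗ᵗ-cong f≈v g≈w) (Hᴿ.trans (H.bilinear-⟨⟩ _⋆ʷ_ v w) words)
  where
  words : v ⋆ʷ w ≈ ks ⋆ᶻ ls
  words rewrite p | q = Hᴿ.refl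

zs-parse : ∀ w {ks} → parse 0 w ≡ just ks → zs ks ≈ ⟨ w ⟩
zs-parse w = go 0 w
  where
  go : ∀ a w {ks} → parse a w ≡ just ks → zs ks ≈ ⟨ replicate a lx ++ w ⟩
  step : ∀ a w {ks} → Maybe.map (suc a ∷_) (parse 0 w) ≡ just ks →
         zs ks ≈ ⟨ replicate a lx ++ ly ∷ w ⟩
  shift : ∀ a w → lx ∷ replicate a lx ++ w ≡ replicate a lx ++ lx ∷ w
  shift zero    w = refl
  shift (suc a) w = ≡.cong (lx ∷_) (shift a w)
  go zero    []       refl = Hᴿ.refl
  go zero    (lx ∷ w) eq   = go 1 w eq
  go (suc a) (lx ∷ w) eq   =
    Hᴿ.trans (go (suc (suc a)) w eq) (Hᴿ.reflexive (≡.cong ⟨_⟩ (shift (suc a) w)))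
  go zero    (ly ∷ w) eq   = step zero w eq
  go (suc a) (ly ∷ w) eq   = step (suc a) w eq
  step a w eq with parse 0 w in eq' | eq
  ... | just ks | refl = Hᴿ.trans (Hᴿ.*-congˡ (go 0 w eq')) (z-⟨⟩ (suc a) w)

⋆ᶻ-identityʳ : ∀ ks → ks ⋆ᶻ [] ≈ zs ks
⋆ᶻ-identityʳ []      = Hᴿ.refl
⋆ᶻ-identityʳ (_ ∷ _) = Hᴿ.refl

∗ᵗ-identityˡ : ∀ {w} → Word¹ w → H.1ᴬ ∗ᵗ ⟨ w ⟩ ≈ ⟨ w ⟩
∗ᵗ-identityˡ {w} w∈ with Word¹⇒≈z w∈
... | ks , eq = Hᴿ.trans (∗ᵗ-≈z ([] , Hᴿ.refl , refl) (w , Hᴿ.refl , eq)) (zs-parse w eq)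

∗ᵗ-identityʳ : ∀ {w} → Word¹ w → ⟨ w ⟩ ∗ᵗ H.1ᴬ ≈ ⟨ w ⟩
∗ᵗ-identityʳ {w} w∈ with Word¹⇒≈z w∈
... | ks , eq = Hᴿ.trans (∗ᵗ-≈z (w , Hᴿ.refl , eq) ([] , Hᴿ.refl , refl))
                  (Hᴿ.trans (⋆ᶻ-identityʳ ks) (zs-parse w eq))

∗ᵗ-z-z : ∀ {w₁ w₂} → Word¹ w₁ → Word¹ w₂ → ∀ {k l} → 1 ℕ.≤ k → 1 ℕ.≤ l →
  (z k · ⟨ w₁ ⟩) ∗ᵗ (z l · ⟨ w₂ ⟩) ≈
      z k · (⟨ w₁ ⟩ ∗ᵗ (z l · ⟨ w₂ ⟩))
    + z l · ((z k · ⟨ w₁ ⟩) ∗ᵗ ⟨ w₂ ⟩)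
    + (1ₜ -ₜ 2 ×ₜ t) • z (k ℕ.+ l) · (⟨ w₁ ⟩ ∗ᵗ ⟨ w₂ ⟩)
    + ((1ₜ -ₜ δ₁ w₁ *ₜ δ₁ w₂) *ₜ (t ^ₜ 2 -ₜ t)) • x ^ (k ℕ.+ l) · (⟨ w₁ ⟩ ∗ᵗ ⟨ w₂ ⟩)
∗ᵗ-z-z {w₁} {w₂} w₁∈ w₂∈ {k} {l} 1≤k 1≤l
  with Word¹⇒≈z w₁∈ | Word¹⇒≈z w₂∈
... | ks , p | ls , q rewrite parse-δ₁ w₁ p | parse-δ₁ w₂ q =
  Hᴿ.trans (∗ᵗ-≈z kf lg) (Hᴿ.sym
    (Hᴿ.+-cong (Hᴿ.+-cong (Hᴿ.+-cong
      (Hᴿ.*-congˡ (∗ᵗ-≈z f lg))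
      (Hᴿ.*-congˡ (∗ᵗ-≈z kf g)))
      (H.•-cong Pᴿ.refl (Hᴿ.*-congˡ (∗ᵗ-≈z f g))))
      (H.•-cong Pᴿ.refl (Hᴿ.*-congˡ (∗ᵗ-≈z f g)))))
  where
  f : ⟨ w₁ ⟩ ≈z ks
  f = w₁ , Hᴿ.refl , p
  g : ⟨ w₂ ⟩ ≈z ls
  g = w₂ , Hᴿ.refl , q
  kf : (z k · ⟨ w₁ ⟩) ≈z (k ∷ ks)
  kf = z-≈z k 1≤k f
  lg : (z l · ⟨ w₂ ⟩) ≈z (l ∷ ls)
  lg = z-≈z l 1≤l g

private
  Ends-y : 𝔥 → Set
  Ends-y f = ∃ λ g → f ≈ g · y

  Ends-y-+ : ∀ {f g} → Ends-y f → Ends-y g → Ends-y (f + g)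
  Ends-y-+ (f' , p) (g' , q) =
    f' + g' , Hᴿ.trans (Hᴿ.+-cong p q) (Hᴿ.sym (Hᴿ.distribʳ y f' g'))

  Ends-y-· : ∀ h {f} → Ends-y f → Ends-y (h · f)
  Ends-y-· h (f' , p) = h · f' , Hᴿ.trans (Hᴿ.*-congˡ p) (Hᴿ.sym (Hᴿ.*-assoc h f' y))

  Ends-y-• : ∀ c {f} → Ends-y f → Ends-y (c • f)
  Ends-y-• c (f' , p) = c • f' , Hᴿ.trans (H.•-cong Pᴿ.refl p) (Hᴿ.sym (H.•-· c f' y))

  Ends-y-z1 : ∀ k → Ends-y (z k · H.1ᴬ)
  Ends-y-z1 k = x ^ (k ∸ 1) , Hᴿ.*-identityʳ (z k)

  0•-≈ : ∀ {c} f → c ≈ₜ 0ₜ → c • f ≈ H.0ᴬ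
  0•-≈ {c} f c≈0 = H.mk≈ λ m →
    Pᴿ.trans (H.coeff-• c f m) (Pᴿ.trans (Pᴿ.*-congʳ c≈0) (Pᴿ.zeroˡ _))

  Ends-y-zs : ∀ k ks → Ends-y (zs (k ∷ ks))
  Ends-y-zs k []        = Ends-y-z1 k
  Ends-y-zs k (k' ∷ ks) = Ends-y-· (z k) (Ends-y-zs k' ks)

  Ends-y-⋆ᶻˡ : ∀ k ks ls → Ends-y ((k ∷ ks) ⋆ᶻ ls)
  Ends-y-⋆ᶻʳ : ∀ ks l ls → Ends-y (ks ⋆ᶻ (l ∷ ls))

  Ends-y-⋆ᶻʳ []       l ls = Ends-y-zs l ls
  Ends-y-⋆ᶻʳ (k ∷ ks) l ls = Ends-y-⋆ᶻˡ k ks (l ∷ ls)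

  Ends-y-⋆ᶻˡ k ks       []       = Ends-y-zs k ks
  Ends-y-⋆ᶻˡ k ks       (l ∷ ls) = Ends-y-+ (Ends-y-+ (Ends-y-+
    (Ends-y-· (z k) (Ends-y-⋆ᶻʳ ks l ls))
    (Ends-y-· (z l) (Ends-y-⋆ᶻˡ k ks ls)))
    (Ends-y-• (1ₜ -ₜ 2 ×ₜ t) (third ks ls)))
    (fourth ks ls)
    where
    third : ∀ ks ls → Ends-y (z (k ℕ.+ l) · (ks ⋆ᶻ ls))
    third []        []        = Ends-y-z1 (k ℕ.+ l)
    third []        (l' ∷ ls) = Ends-y-· (z (k ℕ.+ l)) (Ends-y-⋆ᶻʳ [] l' ls)
    third (k' ∷ ks) ls        = Ends-y-· (z (k ℕ.+ l)) (Ends-y-⋆ᶻˡ k' ks ls)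

    c : ∀ ks ls → ℚ[t]
    c ks ls = (1ₜ -ₜ δ₁ ks *ₜ δ₁ ls) *ₜ (t ^ₜ 2 -ₜ t)

    fourth : ∀ (ks ls : List ℕ) → Ends-y (c ks ls • x ^ (k ℕ.+ l) · (ks ⋆ᶻ ls))
    fourth [] [] = H.0ᴬ , flip Hᴿ.trans (Hᴿ.sym (Hᴿ.zeroˡ y)) (0•-≈ (x ^ (k ℕ.+ l) · H.1ᴬ)
      (Pᴿ.trans (Pᴿ.*-congʳ (Pᴿ.trans
        (Pᴿ.+-congˡ (Pᴿ.-‿cong (Pᴿ.*-identityˡ 1ₜ))) (Pᴿ.-‿inverseʳ 1ₜ)))
        (Pᴿ.zeroˡ (t ^ₜ 2 -ₜ t))))
    fourth []        (l' ∷ ls) = Ends-y-• (c [] (l' ∷ ls))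
      (Ends-y-· (x ^ (k ℕ.+ l)) (Ends-y-⋆ᶻʳ [] l' ls))
    fourth (k' ∷ ks) ls        = Ends-y-• (c (k' ∷ ks) ls)
      (Ends-y-· (x ^ (k ℕ.+ l)) (Ends-y-⋆ᶻˡ k' ks ls))

  ∈𝔥¹-0 : H.0ᴬ ∈𝔥¹
  ∈𝔥¹-0 = 0ₜ , H.0ᴬ , Hᴿ.sym (Hᴿ.trans (Hᴿ.+-cong (0•-≈ H.1ᴬ Pᴿ.refl) (Hᴿ.zeroˡ y))
    (Hᴿ.+-identityʳ H.0ᴬ))

  Ends-y⇒∈𝔥¹ : ∀ {f} → Ends-y f → f ∈𝔥¹
  Ends-y⇒∈𝔥¹ (g , p) = 0ₜ , g , Hᴿ.trans p
    (Hᴿ.trans (Hᴿ.sym (Hᴿ.+-identityˡ _)) (Hᴿ.+-congʳ (Hᴿ.sym (0•-≈ H.1ᴬ Pᴿ.refl))))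

  ∈𝔥¹-+ : ∀ {f g} → f ∈𝔥¹ → g ∈𝔥¹ → (f + g) ∈𝔥¹
  ∈𝔥¹-+ (c , f' , p) (d , g' , q) = (c Pᴿ.+ d) , f' + g' ,
    Hᴿ.trans (Hᴿ.+-cong p q) (Hᴿ.trans (interchange _ _ _ _)
      (Hᴿ.+-cong (Hᴿ.sym •-+) (Hᴿ.sym (Hᴿ.distribʳ y f' g'))))
    where
    open import Algebra.Properties.CommutativeSemigroup
      (CommutativeMonoid.commutativeSemigroup Hᴿ.+-commutativeMonoid) using (interchange)
    •-+ : (c Pᴿ.+ d) • H.1ᴬ ≈ c • H.1ᴬ + d • H.1ᴬ
    •-+ = H.mk≈ λ m → Pᴿ.trans (H.coeff-• (c Pᴿ.+ d) H.1ᴬ m)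
      (Pᴿ.trans (Pᴿ.distribʳ _ c d)
      (Pᴿ.trans (Pᴿ.+-cong (Pᴿ.sym (H.coeff-• c H.1ᴬ m)) (Pᴿ.sym (H.coeff-• d H.1ᴬ m)))
        (Pᴿ.sym (H.coeff-+ (c • H.1ᴬ) (d • H.1ᴬ) m))))

  ∈𝔥¹-• : ∀ c {f} → f ∈𝔥¹ → (c • f) ∈𝔥¹
  ∈𝔥¹-• c {f} (d , f' , p) = c *ₜ d , c • f' , H.mk≈ λ m →
    Pᴿ.trans (H.coeff-≈ (H.•-cong (Pᴿ.refl {c}) p) m)
    (Pᴿ.trans (H.coeff-• c (d • H.1ᴬ + f' · y) m)
    (Pᴿ.trans (Pᴿ.*-congˡ (H.coeff-+ (d • H.1ᴬ) (f' · y) m))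
    (Pᴿ.trans (Pᴿ.distribˡ c _ _)
    (Pᴿ.trans (Pᴿ.+-cong
      (Pᴿ.trans (Pᴿ.*-congˡ (H.coeff-• d H.1ᴬ m))
        (Pᴿ.trans (Pᴿ.sym (Pᴿ.*-assoc c d _)) (Pᴿ.sym (H.coeff-• (c *ₜ d) H.1ᴬ m))))
      (Pᴿ.trans (Pᴿ.sym (H.coeff-• c (f' · y) m))
        (Pᴿ.sym (H.coeff-≈ (H.•-· c f' y) m))))
      (Pᴿ.sym (H.coeff-+ ((c *ₜ d) • H.1ᴬ) ((c • f') · y) m))))))

  opaque
    unfolding H.linear H._+_

    ∈𝔥¹-linear : ∀ F → (∀ w → F w ∈𝔥¹) → ∀ f → H.linear F f ∈𝔥¹
    ∈𝔥¹-linear F F∈ []            = ∈𝔥¹-0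
    ∈𝔥¹-linear F F∈ ((c , w) ∷ f) = ∈𝔥¹-+ (∈𝔥¹-• c (F∈ w)) (∈𝔥¹-linear F F∈ f)

  ⋆ᶻ-∈𝔥¹ : ∀ ks ls → (ks ⋆ᶻ ls) ∈𝔥¹
  ⋆ᶻ-∈𝔥¹ []       []       = 1ₜ , H.0ᴬ ,
    Hᴿ.sym (Hᴿ.trans (Hᴿ.+-cong 1•1≈1 (Hᴿ.zeroˡ y)) (Hᴿ.+-identityʳ H.1ᴬ))
    where
    1•1≈1 : 1ₜ • H.1ᴬ ≈ H.1ᴬ
    1•1≈1 = H.mk≈ λ m → Pᴿ.trans (H.coeff-• 1ₜ H.1ᴬ m) (Pᴿ.*-identityˡ _)
  ⋆ᶻ-∈𝔥¹ []       (l ∷ ls) = Ends-y⇒∈𝔥¹ (Ends-y-⋆ᶻʳ [] l ls)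
  ⋆ᶻ-∈𝔥¹ (k ∷ ks) ls       = Ends-y⇒∈𝔥¹ (Ends-y-⋆ᶻˡ k ks ls)

  ⋆ʷ-∈𝔥¹ : ∀ v w → (v ⋆ʷ w) ∈𝔥¹
  ⋆ʷ-∈𝔥¹ v w with parse 0 v | parse 0 w
  ... | just ks | just ls = ⋆ᶻ-∈𝔥¹ ks ls
  ... | just _  | nothing = ∈𝔥¹-0
  ... | nothing | _       = ∈𝔥¹-0

∗ᵗ-∈𝔥¹ : ∀ f g → (f ∗ᵗ g) ∈𝔥¹
∗ᵗ-∈𝔥¹ f g = ∈𝔥¹-linear _ (λ v → ∈𝔥¹-linear (v ⋆ʷ_) (⋆ʷ-∈𝔥¹ v) g) f

{-# OPTIONS --safe #-}

-- The words z_p^n ∗ z_u z_p^v are expanded by induction on n: each use of the defining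
-- recursion moves one letter z_p to the front or makes z_u meet it.  One further use of
-- the recursion, together with commutativity of ∗, reduces the theorem to two such expansions.

module Submission where

open import Defs
open import Algebra.Bundles using (CommutativeRing; Ring)
open import Data.Fin.Base using (toℕ)
open import Data.List.Base using ([]; _∷_; replicate)
open import Data.Nat.Base as ℕ using (ℕ; zero; suc; _∸_; _≤_)
import Data.Nat.Properties as ℕₚ
open import Data.Product.Base using (_,_)
open import Relation.Binary.PropositionalEquality as ≡ using (_≡_; refl)

private
  module Hᴿ = Ring H.ring
  module Pᴿ = CommutativeRing ℚ[t]-commutativeRing

open import Algebra.Properties.Semiring.Sum Hᴿ.semiring
  using (sum-cong-≋; *-distribˡ-sum)
open import Algebra.Solver.CommutativeMonoid Hᴿ.+-commutativeMonoid
  using (solve; _⊜_; _⊕_)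
open import Relation.Binary.Reasoning.Setoid Hᴿ.setoid

-- Translates the emptiness test of the recursion into the Kronecker deltas of the theorem.
δ₁-replicate : ∀ n (p : ℕ) → δ₁ (replicate n p) ≡ δ n 0
δ₁-replicate zero    p = refl
δ₁-replicate (suc n) p = refl

^-≈z : ∀ {p} → 1 ≤ p → ∀ n → (z p ^ n) ≈z replicate n p
^-≈z 1≤p zero    = [] , Hᴿ.refl , refl
^-≈z 1≤p (suc n) = z-≈z _ 1≤p (^-≈z 1≤p n)

-- The recursion is symmetric: exchanging the arguments swaps the first two terms, while the other
-- two involve `k` and `l` only through their sum and the two deltas only through their product.
⋆ᶻ-comm : ∀ ks ls → ks ⋆ᶻ ls ≈ ls ⋆ᶻ ks
⋆ᶻ-comm []       ls       = Hᴿ.sym (⋆ᶻ-identityʳ ls)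
⋆ᶻ-comm (k ∷ ks) []       = Hᴿ.refl
⋆ᶻ-comm (k ∷ ks) (l ∷ ls) = Hᴿ.+-cong (Hᴿ.+-cong
  (Hᴿ.trans (Hᴿ.+-comm _ _)
    (Hᴿ.+-cong (Hᴿ.*-congˡ (⋆ᶻ-comm (k ∷ ks) ls)) (Hᴿ.*-congˡ (⋆ᶻ-comm ks (l ∷ ls)))))
  (H.•-cong Pᴿ.refl
    (Hᴿ.*-cong (Hᴿ.reflexive (≡.cong z (ℕₚ.+-comm k l))) (⋆ᶻ-comm ks ls))))
  (H.•-cong (Pᴿ.*-congʳ (Pᴿ.+-congˡ (Pᴿ.-‿cong (Pᴿ.*-comm (δ₁ ks) (δ₁ ls)))))
    (Hᴿ.*-cong (Hᴿ.reflexive (≡.cong (x ^_) (ℕₚ.+-comm k l))) (⋆ᶻ-comm ks ls)))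

∗ᵗ-comm : ∀ {f g ks ls} → f ≈z ks → g ≈z ls → f ∗ᵗ g ≈ g ∗ᵗ f
∗ᵗ-comm {ks = ks} {ls} f≈ g≈ =
  Hᴿ.trans (∗ᵗ-≈z f≈ g≈) (Hᴿ.trans (⋆ᶻ-comm ks ls) (Hᴿ.sym (∗ᵗ-≈z g≈ f≈)))

1-2t t²-t : ℚ[t]
1-2t = 1ₜ -ₜ 2 ×ₜ t
t²-t = t ^ₜ 2 -ₜ t

-- Transported from `⋆ᶻ` on lists, where this is the defining clause.
∗ᵗ-zz^ : ∀ {k l p} → 1 ≤ k → 1 ≤ l → 1 ≤ p → ∀ n v →
  (z k · z p ^ n) ∗ᵗ (z l · z p ^ v) ≈
      z k · (z p ^ n ∗ᵗ (z l · z p ^ v))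
    + z l · ((z k · z p ^ n) ∗ᵗ z p ^ v)
    + 1-2t • z (k ℕ.+ l) · (z p ^ n ∗ᵗ z p ^ v)
    + ((1ₜ -ₜ δ n 0 *ₜ δ v 0) *ₜ t²-t) • x ^ (k ℕ.+ l) · (z p ^ n ∗ᵗ z p ^ v)
∗ᵗ-zz^ {k} {l} {p} 1≤k 1≤l 1≤p n v
  rewrite ≡.sym (δ₁-replicate n p) | ≡.sym (δ₁-replicate v p) =
  Hᴿ.trans (∗ᵗ-≈z kf lg) (Hᴿ.sym
    (Hᴿ.+-cong (Hᴿ.+-cong (Hᴿ.+-cong
      (Hᴿ.*-congˡ (∗ᵗ-≈z f lg))
      (Hᴿ.*-congˡ (∗ᵗ-≈z kf g)))
      (H.•-cong Pᴿ.refl (Hᴿ.*-congˡ (∗ᵗ-≈z f g))))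
      (H.•-cong Pᴿ.refl (Hᴿ.*-congˡ (∗ᵗ-≈z f g)))))
  where
  f  = ^-≈z 1≤p n
  g  = ^-≈z 1≤p v
  kf = z-≈z k 1≤k f
  lg = z-≈z l 1≤l g

-- The summands are compared only at positive indices, where `∑` runs. This matters for `block`,
-- whose shift by z_p fails at index 0 because `i ∸ 1` is truncated.
·-∑ : ∀ h n (f g : ℕ → 𝔥) → (∀ i → h · f (suc i) ≈ g (suc i)) → h · ∑ n f ≈ ∑ n g
·-∑ h n f g hf≈g = Hᴿ.trans (*-distribˡ-sum {n} h (λ i → f (suc (toℕ i))))
  (sum-cong-≋ {n} (λ i → hf≈g (toℕ i)))

-- The braces of the theorem, with the Kronecker factor abstracted to `d`: left multiplication by
-- z_p raises `i` but keeps that factor.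
block : (p u i : ℕ) → ℚ[t] → 𝔥
block p u i d = z p ^ i · z u
  + 1-2t • z p ^ (i ∸ 1) · z (u ℕ.+ p)
  + (d *ₜ t²-t) • z p ^ (i ∸ 1) · x ^ (u ℕ.+ p)

block-suc : ∀ p u i d → z p · block p u (suc i) d ≈ block p u (suc (suc i)) d
block-suc p u i d = begin
  z p · (a + 1-2t • b + e • c)
    ≈⟨ H.·-+ʳ (z p) (a + 1-2t • b) (e • c) ⟩
  z p · (a + 1-2t • b) + z p · (e • c)
    ≈⟨ Hᴿ.+-congʳ (H.·-+ʳ (z p) a (1-2t • b)) ⟩
  z p · a + z p · (1-2t • b) + z p · (e • c)
    ≈⟨ Hᴿ.+-cong (Hᴿ.+-cong (assoc _ _) (scaled 1-2t _)) (scaled e _) ⟩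
  block p u (suc (suc i)) d ∎
  where
  a = z p ^ suc i · z u
  b = z p ^ i · z (u ℕ.+ p)
  c = z p ^ i · x ^ (u ℕ.+ p)
  e = d *ₜ t²-t
  assoc : ∀ f g → z p · (f · g) ≈ (z p · f) · g
  assoc f g = Hᴿ.sym (Hᴿ.*-assoc (z p) f g)
  scaled : ∀ r {f} g → z p · (r • f · g) ≈ r • (z p · f) · g
  scaled r {f} g = Hᴿ.trans (H.·-• r (z p) (f · g)) (H.•-cong Pᴿ.refl (assoc f g))

-- At index 1 the powers z_p^0 disappear, leaving the terms that a single use of the recursion
-- contributes to the sum.
block-1 : ∀ p u d w → block p u 1 d · w ≈
  z p · (z u · w) + 1-2t • z (u ℕ.+ p) · w + (d *ₜ t²-t) • x ^ (u ℕ.+ p) · w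
block-1 p u d w = begin
  (a + 1-2t • b + e • c) · w
    ≈⟨ H.·-+ˡ (a + 1-2t • b) (e • c) w ⟩
  (a + 1-2t • b) · w + (e • c) · w
    ≈⟨ Hᴿ.+-congʳ (H.·-+ˡ a (1-2t • b) w) ⟩
  a · w + (1-2t • b) · w + (e • c) · w
    ≈⟨ Hᴿ.+-cong (Hᴿ.+-cong
         (Hᴿ.trans (Hᴿ.*-congʳ (Hᴿ.*-congʳ (Hᴿ.*-identityʳ (z p)))) (Hᴿ.*-assoc (z p) (z u) w))
         (scaled 1-2t (z (u ℕ.+ p)))) (scaled e (x ^ (u ℕ.+ p))) ⟩
  z p · (z u · w) + 1-2t • z (u ℕ.+ p) · w + e • x ^ (u ℕ.+ p) · w ∎
  where
  a = z p ^ 1 · z u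
  b = H.1ᴬ · z (u ℕ.+ p)
  c = H.1ᴬ · x ^ (u ℕ.+ p)
  e = d *ₜ t²-t
  scaled : ∀ r f → (r • H.1ᴬ · f) · w ≈ r • f · w
  scaled r f = Hᴿ.trans (H.•-· r (H.1ᴬ · f) w)
    (H.•-cong Pᴿ.refl (Hᴿ.*-congʳ (Hᴿ.*-identityˡ f)))

-- Induction on `n`. In the recursion for z_p^(n+1), the term that starts with z_u is kept. The term
-- that starts with z_p is expanded by the induction hypothesis: its sum, multiplied by z_p, gives
-- the summands with i at least 2, and its leading term joins the two contraction terms to form the
-- summand i = 1.
z^-∗ᵗ-zz^ : ∀ {u p} → 1 ≤ u → 1 ≤ p → ∀ n v →
  z p ^ n ∗ᵗ (z u · z p ^ v) ≈
      z u · (z p ^ n ∗ᵗ z p ^ v)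
    + ∑ n (λ i → block p u i (1ₜ -ₜ δ v 0 *ₜ δ n i) · (z p ^ v ∗ᵗ z p ^ (n ∸ i)))
z^-∗ᵗ-zz^ {u} {p} 1≤u 1≤p zero v = begin
  H.1ᴬ ∗ᵗ (z u · z p ^ v)            ≈⟨ unit (z-≈z u 1≤u (^-≈z 1≤p v)) ⟩
  z u · z p ^ v                      ≈⟨ Hᴿ.*-congˡ (unit (^-≈z 1≤p v)) ⟨
  z u · (H.1ᴬ ∗ᵗ z p ^ v)            ≈⟨ Hᴿ.+-identityʳ _ ⟨
  z u · (H.1ᴬ ∗ᵗ z p ^ v) + H.0ᴬ     ∎
  where
  unit : ∀ {f ks} → f ≈z ks → H.1ᴬ ∗ᵗ f ≈ f
  unit f≈@(w , f≈w , eq) =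
    Hᴿ.trans (∗ᵗ-≈z ([] , Hᴿ.refl , refl) f≈) (Hᴿ.trans (zs-parse w eq) (Hᴿ.sym f≈w))
z^-∗ᵗ-zz^ {u} {p} 1≤u 1≤p (suc n) v = begin
  z p ^ suc n ∗ᵗ (z u · z p ^ v)
    ≈⟨ ∗ᵗ-zz^ 1≤p 1≤u 1≤p n v ⟩
  z p · (z p ^ n ∗ᵗ (z u · z p ^ v)) + b + 1-2t • z (p ℕ.+ u) · w
    + ((1ₜ -ₜ δ n 0 *ₜ δ v 0) *ₜ t²-t) • x ^ (p ℕ.+ u) · w
    ≈⟨ Hᴿ.+-cong (Hᴿ.+-cong (Hᴿ.+-congʳ
         (Hᴿ.trans (Hᴿ.*-congˡ (z^-∗ᵗ-zz^ 1≤u 1≤p n v)) (H.·-+ʳ (z p) (z u · w) (∑ n T))))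
         (H.•-cong Pᴿ.refl (Hᴿ.*-cong (Hᴿ.reflexive (≡.cong z (ℕₚ.+-comm p u))) w-comm)))
         (H.•-cong (Pᴿ.*-congʳ (Pᴿ.+-congˡ (Pᴿ.-‿cong (Pᴿ.*-comm (δ n 0) (δ v 0)))))
           (Hᴿ.*-cong (Hᴿ.reflexive (≡.cong (x ^_) (ℕₚ.+-comm p u))) w-comm)) ⟩
  z p · (z u · w) + z p · ∑ n T + b + c + e
    ≈⟨ Hᴿ.+-congʳ (Hᴿ.+-congʳ (Hᴿ.+-congʳ (Hᴿ.+-cong (Hᴿ.*-congˡ (Hᴿ.*-congˡ w-comm))
         (·-∑ (z p) n T T⁺ shift)))) ⟩
  z p · (z u · w′) + ∑ n T⁺ + b + c + e
    ≈⟨ solve 5 (λ a s b c e → (((a ⊕ s) ⊕ b) ⊕ c) ⊕ e ⊜ b ⊕ (((a ⊕ c) ⊕ e) ⊕ s)) Hᴿ.refl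
         (z p · (z u · w′)) (∑ n T⁺) b c e ⟩
  b + (z p · (z u · w′) + c + e + ∑ n T⁺)
    ≈⟨ Hᴿ.+-congˡ (Hᴿ.+-congʳ (block-1 p u (1ₜ -ₜ δ v 0 *ₜ δ n 0) w′)) ⟨
  b + (block p u 1 (1ₜ -ₜ δ v 0 *ₜ δ n 0) · w′ + ∑ n T⁺) ∎
  where
  w  = z p ^ n ∗ᵗ z p ^ v
  w′ = z p ^ v ∗ᵗ z p ^ n
  b  = z u · (z p ^ suc n ∗ᵗ z p ^ v)
  c  = 1-2t • z (u ℕ.+ p) · w′
  e  = ((1ₜ -ₜ δ v 0 *ₜ δ n 0) *ₜ t²-t) • x ^ (u ℕ.+ p) · w′
  T T⁺ : ℕ → 𝔥
  T i  = block p u i (1ₜ -ₜ δ v 0 *ₜ δ n i) · (z p ^ v ∗ᵗ z p ^ (n ∸ i))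
  -- By reduction of `δ (suc n) (suc i)` and `suc n ∸ suc i`, this is summand `suc i` of the sum for
  -- `suc n`; its value at 0 is the head of that sum.
  T⁺ i = block p u (suc i) (1ₜ -ₜ δ v 0 *ₜ δ n i) · (z p ^ v ∗ᵗ z p ^ (n ∸ i))
  w-comm : w ≈ w′
  w-comm = ∗ᵗ-comm (^-≈z 1≤p n) (^-≈z 1≤p v)
  shift : ∀ i → z p · T (suc i) ≈ T⁺ (suc i)
  shift i = Hᴿ.trans (Hᴿ.sym (Hᴿ.*-assoc (z p) _ _))
    (Hᴿ.*-congʳ (block-suc p u i (1ₜ -ₜ δ v 0 *ₜ δ n (suc i))))

theorem2 : ∀ (m u p n v : ℕ) → 1 ≤ m → 1 ≤ u → 1 ≤ p →
    (z m · z p ^ n) ∗ᵗ (z u · z p ^ v) ≈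
    ∑ n (λ i →
    z m ·
    ( z p ^ i · z u
    + (1ₜ -ₜ 2 ×ₜ t) • z p ^ (i ∸ 1) · z (u ℕ.+ p)
    + ((1ₜ -ₜ δ v 0 *ₜ δ n i) *ₜ (t ^ₜ 2 -ₜ t)) • z p ^ (i ∸ 1) · x ^ (u ℕ.+ p) )
    · (z p ^ v ∗ᵗ z p ^ (n ∸ i)))
    + ∑ v (λ i →
    z u ·
    ( z p ^ i · z m
    + (1ₜ -ₜ 2 ×ₜ t) • z p ^ (i ∸ 1) · z (m ℕ.+ p)
    + ((1ₜ -ₜ δ n 0 *ₜ δ v i) *ₜ (t ^ₜ 2 -ₜ t)) • z p ^ (i ∸ 1) · x ^ (m ℕ.+ p) )
    · (z p ^ n ∗ᵗ z p ^ (v ∸ i)))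
    + ( z m · z u
    + z u · z m
    + (1ₜ -ₜ 2 ×ₜ t) • z (m ℕ.+ u)
    + ((1ₜ -ₜ δ n 0 *ₜ δ v 0) *ₜ (t ^ₜ 2 -ₜ t)) • x ^ (m ℕ.+ u) )
    · (z p ^ n ∗ᵗ z p ^ v)
theorem2 m u p n v 1≤m 1≤u 1≤p = begin
  (z m · z p ^ n) ∗ᵗ (z u · z p ^ v)
    ≈⟨ ∗ᵗ-zz^ 1≤m 1≤u 1≤p n v ⟩
  z m · (z p ^ n ∗ᵗ (z u · z p ^ v)) + z u · ((z m · z p ^ n) ∗ᵗ z p ^ v)
    + 1-2t • z (m ℕ.+ u) · w + e • x ^ (m ℕ.+ u) · w
    ≈⟨ Hᴿ.+-cong (Hᴿ.+-cong (Hᴿ.+-cong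
         (expand m u n v Hᴿ.refl (z^-∗ᵗ-zz^ 1≤u 1≤p n v))
         -- Commutativity puts the pure power z_p^v on the left, so the same expansion applies with
         -- m, u and n, v exchanged.
         (expand u m v n (∗ᵗ-comm (^-≈z 1≤p v) (^-≈z 1≤p n))
           (Hᴿ.trans (∗ᵗ-comm (z-≈z m 1≤m (^-≈z 1≤p n)) (^-≈z 1≤p v))
             (z^-∗ᵗ-zz^ 1≤m 1≤p v n))))
         (Hᴿ.sym (H.•-· 1-2t (z (m ℕ.+ u)) w)))
         (Hᴿ.sym (H.•-· e (x ^ (m ℕ.+ u)) w)) ⟩
  a · w + S m u n v + (b · w + S u m v n) + c · w + d · w
    ≈⟨ solve 6 (λ a s b s′ c d →
         (((a ⊕ s) ⊕ (b ⊕ s′)) ⊕ c) ⊕ d ⊜ (s ⊕ s′) ⊕ (((a ⊕ b) ⊕ c) ⊕ d)) Hᴿ.refl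
         (a · w) (S m u n v) (b · w) (S u m v n) (c · w) (d · w) ⟩
  S m u n v + S u m v n + (a · w + b · w + c · w + d · w)
    ≈⟨ Hᴿ.+-congˡ (Hᴿ.trans (H.·-+ˡ (a + b + c) d w) (Hᴿ.+-congʳ
         (Hᴿ.trans (H.·-+ˡ (a + b) c w) (Hᴿ.+-congʳ (H.·-+ˡ a b w))))) ⟨
  S m u n v + S u m v n + (a + b + c + d) · w ∎
  where
  w = z p ^ n ∗ᵗ z p ^ v
  e = (1ₜ -ₜ δ n 0 *ₜ δ v 0) *ₜ t²-t
  a = z m · z u
  b = z u · z m
  c = 1-2t • z (m ℕ.+ u)
  d = e • x ^ (m ℕ.+ u)
  B : (l i n v : ℕ) → 𝔥
  B l i n v = block p l i (1ₜ -ₜ δ v 0 *ₜ δ n i)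
  W : (i n v : ℕ) → 𝔥
  W i n v = z p ^ v ∗ᵗ z p ^ (n ∸ i)
  S : (k l n v : ℕ) → 𝔥
  S k l n v = ∑ n (λ i → z k · B l i n v · W i n v)
  -- Covers both products left by the recursion. The hypothesis on `w` absorbs the reversed order of
  -- the powers in the second one, so that both leading terms end in the same factor.
  expand : ∀ k l n v {f} → z p ^ n ∗ᵗ z p ^ v ≈ w →
    f ≈ z l · (z p ^ n ∗ᵗ z p ^ v) + ∑ n (λ i → B l i n v · W i n v) →
    z k · f ≈ (z k · z l) · w + S k l n v
  expand k l n v {f} w≈ f≈ = begin
    z k · f
      ≈⟨ Hᴿ.*-congˡ (Hᴿ.trans f≈ (Hᴿ.+-congʳ (Hᴿ.*-congˡ w≈))) ⟩
    z k · (z l · w + ∑ n (λ i → B l i n v · W i n v))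
      ≈⟨ H.·-+ʳ (z k) (z l · w) _ ⟩
    z k · (z l · w) + z k · ∑ n (λ i → B l i n v · W i n v)
      ≈⟨ Hᴿ.+-cong (Hᴿ.sym (Hᴿ.*-assoc (z k) (z l) w))
           (·-∑ (z k) n (λ i → B l i n v · W i n v) (λ i → z k · B l i n v · W i n v)
             (λ i → Hᴿ.sym (Hᴿ.*-assoc (z k) (B l (suc i) n v) (W (suc i) n v)))) ⟩
    (z k · z l) · w + S k l n v ∎
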